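{- Let $\mathcal{P}$ be a finite poset with order relation $<_p$. Suppose the elements of $\mathcal{P}$ are colored with the colors $1,2,\dots,k$ (each element has exactly one color and all colors are used), and the coloring is order-preserving: if $a<_p b$ then the color of $a$ is smaller than the color of $b$. Then there exists a constant $C$ (depending on $\mathcal{P}$ and its coloring) such that for every $n$ and every family $\mathcal{F}$ of subsets of $[n]$ with $|\mathcal{F}|>C\binom{n}{\lfloor\frac{n}{2}\rfloor}$, there is an embedding $f:\mathcal{P}\to\mathcal{F}$ that maps all elements of the same color to sets of the same size.
   Context: $[n]=\{1,2,\dots,n\}$. A map $f$ from a poset $\mathcal{P}$ to subsets of $[n]$ is an embedding if it is injective and $f(a)\subset f(b)$ whenever $a<_p b$. -}

module Defs where

open import Data.Nat using (ℕ)
open import Data.Fin using (Fin)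
open import Data.Fin.Subset using (Subset; _⊂_; ∣_∣)
open import Data.List using (List)
open import Data.List.Membership.Propositional using (_∈_)
open import Data.Product using (_×_)
open import Relation.Binary.PropositionalEquality using (_≡_)
open import Relation.Binary.Core using (Rel)
open import Function.Definitions using (Injective)

record ColorEmbedding {m k n : ℕ} (_<p_ : Rel (Fin m) _) (c : Fin m → Fin k)
                      (F : List (Subset n)) (f : Fin m → Subset n) : Set where
  field
    injective   : Injective _≡_ _≡_ f
    monotone    : ∀ {a b} → a <p b → f a ⊂ f b
    inFamily    : ∀ a → f a ∈ F
    colorLevels : ∀ a b → c a ≡ c b → ∣ f a ∣ ≡ ∣ f b ∣

{-# OPTIONS --safe #-}

-- Colours are ordered, so it suffices to find, for each colour i, m distinct sets of F of one size
-- such that every set chosen for i is a proper subset of every set chosen for i′ whenever i < i′.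
--
-- Call Y rich in G if some Z in G has more than s members of G of a common size in [Z, Y]. If the
-- members of G are all non-rich in G, the Lubell function of G (the expected number of members on
-- a random maximal chain) is at most 3 s: as long as ∅ or the full set is missing from G, average
-- over the facets through the other one and induct on n; when both belong to G, every level of G
-- has at most s members, and the sum of 1 / (n C t) over t is at most 3.
--
-- So a family with Lubell function above k * 3 s stays above (k - 1) * 3 s after its non-rich
-- members are discarded. By induction there are k - 1 levels above some Y that is rich in the
-- family, and richness provides one more level below Y.
module Submission where

open import Defs
open import Level using (0ℓ)
open import Data.Bool using (Bool; true; false; not; if_then_else_)
import Data.Bool as Bool
open import Data.Nat
open import Data.Nat.Combinatorics using (_C_; k![n∸k]!∣n!)
open import Data.Nat.Combinatorics.Specification using (nCk≡n!/k![n-k]!)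
open import Data.Nat.DivMod using (m≡m%n+[m/n]*n; m%n<n; m/n*n≡m; m/n≤m)
open import Data.Nat.Properties
open import Data.Fin using (Fin; zero; suc; toℕ; fromℕ<; inject≤; splitAt; join; punchIn; _↑ʳ_)
open import Data.Fin using () renaming (_<_ to _<ᶠ_)
import Data.Fin.Properties as Fin
open import Data.Fin.Subset using (Subset; _⊆_; _⊂_; ∣_∣; ⊤; ⊥)
open import Data.Fin.Subset.Properties hiding (_∈?_)
open import Data.List using (List; []; _∷_; length)
open import Data.List.Membership.Propositional using (_∈_)
import Data.List.Membership.DecPropositional as DecMembership
import Data.List.Relation.Unary.All as All
open import Data.List.Relation.Unary.AllPairs using () renaming ([] to []ᵘ; _∷_ to _∷ᵘ_)
open import Data.List.Relation.Unary.Unique.Propositional using (Unique)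
open import Data.Product using (Σ; ∃; _×_; _,_; proj₁; proj₂)
open import Data.Sum using (_⊎_; inj₁; inj₂; [_,_]′)
open import Data.Vec using ([]; _∷_; here; there; count; insertAt; replicate)
open import Data.Vec.Properties using (≡-dec; ∷-injectiveʳ)
open import Function using (_∘_; id)
open import Function.Definitions using (Injective; Surjective)
open import Relation.Binary.Core using (Rel)
open import Relation.Binary.Definitions using (tri<; tri≈; tri>)
open import Relation.Binary.PropositionalEquality
open import Relation.Binary.Structures using (IsStrictPartialOrder)
open import Relation.Nullary using (Dec; yes; no; does; ¬_; contradiction; _×-dec_; ¬?)
open import Relation.Unary using (Pred; Decidable)

open import Algebra.Properties.CommutativeMonoid.Sum +-0-commutativeMonoid
  using (sum; ∑-distrib-+; sum-cong-≗)
open import Algebra.Properties.CommutativeSemigroup +-commutativeSemigroup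
  using () renaming (interchange to +-interchange; x∙yz≈y∙xz to +-swap)
open import Algebra.Properties.CommutativeSemigroup *-commutativeSemigroup
  using () renaming (x∙yz≈y∙xz to *-swap)
open module Membership {n : ℕ} = DecMembership (≡-dec {n = n} Bool._≟_) using (_∈?_)

private
  variable
    n : ℕ
    P Q : Set

-- Sums over all subsets of [n] and over `Fin k`.

∑ : (Subset n → ℕ) → ℕ
∑ {zero}  f = f []
∑ {suc n} f = ∑ (f ∘ (true ∷_)) + ∑ (f ∘ (false ∷_))

∑-cong : {f g : Subset n → ℕ} → (∀ A → f A ≡ g A) → ∑ f ≡ ∑ g
∑-cong {zero}  f≗g = f≗g []
∑-cong {suc n} f≗g = cong₂ _+_ (∑-cong (f≗g ∘ (true ∷_))) (∑-cong (f≗g ∘ (false ∷_)))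

∑-mono : {f g : Subset n → ℕ} → (∀ A → f A ≤ g A) → ∑ f ≤ ∑ g
∑-mono {zero}  f≤g = f≤g []
∑-mono {suc n} f≤g = +-mono-≤ (∑-mono (f≤g ∘ (true ∷_))) (∑-mono (f≤g ∘ (false ∷_)))

∑-distrib : (f g : Subset n → ℕ) → ∑ (λ A → f A + g A) ≡ ∑ f + ∑ g
∑-distrib {zero}  f g = refl
∑-distrib {suc n} f g = trans
  (cong₂ _+_ (∑-distrib (f ∘ (true ∷_)) (g ∘ (true ∷_)))
             (∑-distrib (f ∘ (false ∷_)) (g ∘ (false ∷_))))
  (+-interchange (∑ (f ∘ (true ∷_))) _ _ _)

∑-*ˡ : ∀ c (f : Subset n → ℕ) → ∑ (λ A → c * f A) ≡ c * ∑ f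
∑-*ˡ {zero}  c f = refl
∑-*ˡ {suc n} c f = trans
  (cong₂ _+_ (∑-*ˡ c (f ∘ (true ∷_))) (∑-*ˡ c (f ∘ (false ∷_))))
  (sym (*-distribˡ-+ c _ _))

∑-zero : {f : Subset n → ℕ} → (∀ A → f A ≡ 0) → ∑ f ≡ 0
∑-zero {zero}  f≡0 = f≡0 []
∑-zero {suc n} f≡0 = cong₂ _+_ (∑-zero (f≡0 ∘ (true ∷_))) (∑-zero (f≡0 ∘ (false ∷_)))

∑-sum-comm : ∀ {k} (f : Subset n → Fin k → ℕ) →
             ∑ (λ A → sum (f A)) ≡ sum (λ i → ∑ (λ A → f A i))
∑-sum-comm {k = zero}  f = ∑-zero {f = λ A → sum (f A)} (λ _ → refl)
∑-sum-comm {k = suc k} f = trans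
  (∑-distrib (λ A → f A zero) (λ A → sum (f A ∘ suc)))
  (cong (∑ (λ A → f A zero) +_) (∑-sum-comm (λ A → f A ∘ suc)))

term≤∑ : (f : Subset n → ℕ) (A : Subset n) → f A ≤ ∑ f
term≤∑ f []          = ≤-refl
term≤∑ f (true ∷ A)  = ≤-trans (term≤∑ (f ∘ (true ∷_)) A) (m≤m+n _ _)
term≤∑ f (false ∷ A) = ≤-trans (term≤∑ (f ∘ (false ∷_)) A) (m≤n+m _ _)

∑-insertAt≤ : ∀ (f : Subset (suc n) → ℕ) x b → ∑ (λ A → f (insertAt A x b)) ≤ ∑ f
∑-insertAt≤ f zero true  = m≤m+n _ _
∑-insertAt≤ f zero false = m≤n+m _ _
∑-insertAt≤ {suc n} f (suc x) b =
  +-mono-≤ (∑-insertAt≤ (f ∘ (true ∷_)) x b) (∑-insertAt≤ (f ∘ (false ∷_)) x b)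

sum-mono : ∀ {k} {f g : Fin k → ℕ} → (∀ i → f i ≤ g i) → sum f ≤ sum g
sum-mono {zero}  f≤g = z≤n
sum-mono {suc k} f≤g = +-mono-≤ (f≤g zero) (sum-mono (f≤g ∘ suc))

sum-const : ∀ k c → sum {k} (λ _ → c) ≡ k * c
sum-const zero    c = refl
sum-const (suc k) c = cong (c +_) (sum-const k c)

sum-*ˡ : ∀ {k} c (f : Fin k → ℕ) → sum (λ i → c * f i) ≡ c * sum f
sum-*ˡ {zero}  c f = sym (*-zeroʳ c)
sum-*ˡ {suc k} c f = trans (cong (c * f zero +_) (sum-*ˡ c (f ∘ suc))) (sym (*-distribˡ-+ c _ _))

term≤sum : ∀ {k} (f : Fin k → ℕ) i → f i ≤ sum f
term≤sum f zero    = m≤m+n _ _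
term≤sum f (suc i) = ≤-trans (term≤sum (f ∘ suc) i) (m≤n+m _ _)

-- Indicators, and listing the sets that they count.

⟦_⟧ : Dec P → ℕ
⟦ P? ⟧ = if does P? then 1 else 0

⟦⟧-mono : (P? : Dec P) (Q? : Dec Q) → (P → Q) → ⟦ P? ⟧ ≤ ⟦ Q? ⟧
⟦⟧-mono (no _)  Q?       f = z≤n
⟦⟧-mono (yes p) (yes q)  f = ≤-refl
⟦⟧-mono (yes p) (no ¬q)  f = contradiction (f p) ¬q

⟦⟧-true : (P? : Dec P) → P → ⟦ P? ⟧ ≡ 1
⟦⟧-true (yes _) p = refl
⟦⟧-true (no ¬p) p = contradiction p ¬p

⟦⟧-false : (P? : Dec P) → ¬ P → ⟦ P? ⟧ ≡ 0
⟦⟧-false (yes p) ¬p = contradiction p ¬p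
⟦⟧-false (no _)  ¬p = refl

⟦⟧-split : (P? : Dec P) (Q? : Dec Q) → ⟦ P? ⟧ ≤ ⟦ P? ×-dec Q? ⟧ + ⟦ P? ×-dec ¬? Q? ⟧
⟦⟧-split (no _)  _       = z≤n
⟦⟧-split (yes _) (yes _) = ≤-refl
⟦⟧-split (yes _) (no _)  = ≤-refl

-- The sum over `Subset (suc n)` is by definition the sum over its two halves, so `splitAt` cuts the
-- index type into the indices of either half.
enumerate : {G : Pred (Subset n) 0ℓ} (G? : Decidable G) →
            ∃ λ (u : Fin (∑ (λ A → ⟦ G? A ⟧)) → Subset n) → Injective _≡_ _≡_ u × (∀ i → G (u i))
enumerate {zero} G? with G? []
... | yes g = (λ _ → []) , (λ { {zero} {zero} _ → refl }) , (λ _ → g)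
... | no _  = (λ ()) , (λ { {()} }) , (λ ())
enumerate {suc n} {G} G? with enumerate (G? ∘ (true ∷_)) | enumerate (G? ∘ (false ∷_))
... | u , u-inj , u∈G | v , v-inj , v∈G = w ∘ splitAt k , w∘split-inj , w∈G ∘ splitAt k
  where
  k = ∑ (λ A → ⟦ G? (true ∷ A) ⟧)
  l = ∑ (λ A → ⟦ G? (false ∷ A) ⟧)

  w : Fin k ⊎ Fin l → Subset (suc n)
  w = [ (λ i → true ∷ u i) , (λ j → false ∷ v j) ]′

  w-inj : Injective _≡_ _≡_ w
  w-inj {inj₁ i} {inj₁ j} eq = cong inj₁ (u-inj (∷-injectiveʳ eq))
  w-inj {inj₂ i} {inj₂ j} eq = cong inj₂ (v-inj (∷-injectiveʳ eq))

  w∘split-inj : Injective _≡_ _≡_ (w ∘ splitAt k)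
  w∘split-inj {i} {j} eq = begin
    i                        ≡⟨ Fin.join-splitAt k l i ⟨
    join k l (splitAt k i)   ≡⟨ cong (join k l) (w-inj {splitAt k i} {splitAt k j} eq) ⟩
    join k l (splitAt k j)   ≡⟨ Fin.join-splitAt k l j ⟩
    j                        ∎
    where open ≡-Reasoning

  w∈G : ∀ i → G (w i)
  w∈G (inj₁ i) = u∈G i
  w∈G (inj₂ j) = v∈G j

choose : {G : Pred (Subset n) 0ℓ} (G? : Decidable G) → ∀ {r} → r ≤ ∑ (λ A → ⟦ G? A ⟧) →
         ∃ λ (u : Fin r → Subset n) → Injective _≡_ _≡_ u × (∀ i → G (u i))
choose G? r≤ with enumerate G?
... | u , u-inj , u∈G =
  (λ i → u (inject≤ i r≤)) , (λ eq → Fin.inject≤-injective r≤ r≤ _ _ (u-inj eq)) , (λ i → u∈G _)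

-- Inclusion, insertion of an element, element counts.

⊆⇒≡⊎⊂ : {p q : Subset n} → p ⊆ q → p ≡ q ⊎ p ⊂ q
⊆⇒≡⊎⊂ {p = []}    {[]}    _   = inj₁ refl
⊆⇒≡⊎⊂ {p = true ∷ p}  {false ∷ q} p⊆q = contradiction (p⊆q here) (λ ())
⊆⇒≡⊎⊂ {p = false ∷ p} {true ∷ q}  p⊆q = inj₂ (out⊂in (drop-∷-⊆ p⊆q))
⊆⇒≡⊎⊂ {p = true ∷ p}  {true ∷ q}  p⊆q with ⊆⇒≡⊎⊂ (drop-∷-⊆ p⊆q)
... | inj₁ p≡q = inj₁ (cong (true ∷_) p≡q)
... | inj₂ p⊂q = inj₂ (s⊂s p⊂q)
⊆⇒≡⊎⊂ {p = false ∷ p} {false ∷ q} p⊆q with ⊆⇒≡⊎⊂ (drop-∷-⊆ p⊆q)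
... | inj₁ p≡q = inj₁ (cong (false ∷_) p≡q)
... | inj₂ p⊂q = inj₂ (s⊂s p⊂q)

insertAt-⊆ : ∀ {p q : Subset n} x b → p ⊆ q → insertAt p x b ⊆ insertAt q x b
insertAt-⊆ zero b p⊆q = s⊆s p⊆q
insertAt-⊆ {p = s ∷ p} {t ∷ q} (suc x) b p⊆q here with here ← p⊆q here = here
insertAt-⊆ {p = s ∷ p} {t ∷ q} (suc x) b p⊆q (there y∈) =
  there (insertAt-⊆ x b (drop-∷-⊆ p⊆q) y∈)

-- # true is definitionally ∣_∣, and # false is the size of the complement.
# : Bool → Subset n → ℕ
# b A = count (Bool._≟ b) A

#-insertAt-≡ : ∀ (A : Subset n) x b → # b (insertAt A x b) ≡ suc (# b A)
#-insertAt-≡ A           zero    true  = refl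
#-insertAt-≡ A           zero    false = refl
#-insertAt-≡ (true ∷ A)  (suc x) true  = cong suc (#-insertAt-≡ A x true)
#-insertAt-≡ (true ∷ A)  (suc x) false = #-insertAt-≡ A x false
#-insertAt-≡ (false ∷ A) (suc x) true  = #-insertAt-≡ A x true
#-insertAt-≡ (false ∷ A) (suc x) false = cong suc (#-insertAt-≡ A x false)

#-insertAt-not : ∀ (A : Subset n) x b → # (not b) (insertAt A x b) ≡ # (not b) A
#-insertAt-not A           zero    true  = refl
#-insertAt-not A           zero    false = refl
#-insertAt-not (true ∷ A)  (suc x) true  = #-insertAt-not A x true
#-insertAt-not (true ∷ A)  (suc x) false = cong suc (#-insertAt-not A x false)
#-insertAt-not (false ∷ A) (suc x) true  = cong suc (#-insertAt-not A x true)
#-insertAt-not (false ∷ A) (suc x) false = #-insertAt-not A x false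

#≡0⇒≡replicate : ∀ (A : Subset n) b → # b A ≡ 0 → A ≡ replicate n (not b)
#≡0⇒≡replicate []          b     eq = refl
#≡0⇒≡replicate (true ∷ A)  false eq = cong (true ∷_) (#≡0⇒≡replicate A false eq)
#≡0⇒≡replicate (false ∷ A) true  eq = cong (false ∷_) (#≡0⇒≡replicate A true eq)

#true+#false : ∀ (A : Subset n) → # true A + # false A ≡ n
#true+#false []          = refl
#true+#false (true ∷ A)  = cong suc (#true+#false A)
#true+#false (false ∷ A) = trans (+-suc _ _) (cong suc (#true+#false A))

-- Double counting: a set B arises as `insertAt A x b` from exactly one A at each of the `# b B`
-- positions x where it has the bit `b`, and at no other position.
sum-∑-insertAt : ∀ (f : Subset (suc n) → ℕ) b →
                 sum (λ x → ∑ (λ A → f (insertAt A x b))) ≡ ∑ (λ A → # b A * f A)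
sum-∑-insertAt {zero}  f true  = sym (+-identityʳ _)
sum-∑-insertAt {zero}  f false = refl
sum-∑-insertAt {suc n} f b = begin
  ∑ (f ∘ (b ∷_)) + sum (λ x → T x + F x)
    ≡⟨ cong (∑ (f ∘ (b ∷_)) +_) (∑-distrib-+ T F) ⟩
  ∑ (f ∘ (b ∷_)) + (sum T + sum F)
    ≡⟨ cong₂ (λ t s → ∑ (f ∘ (b ∷_)) + (t + s))
         (sum-∑-insertAt (f ∘ (true ∷_)) b) (sum-∑-insertAt (f ∘ (false ∷_)) b) ⟩
  ∑ (f ∘ (b ∷_)) + (∑ (λ A → # b A * f (true ∷ A)) + ∑ (λ A → # b A * f (false ∷ A)))
    -- Position `zero` yields one extra copy of the half with first bit `b`; this is the `suc` in
    -- `# b (b ∷ A)`, which computes once `b` is split.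
    ≡⟨ absorb b ⟩
  ∑ (λ A → # b A * f A) ∎
  where
  open ≡-Reasoning
  T F : Fin (suc n) → ℕ
  T x = ∑ (λ A → f (true ∷ insertAt A x b))
  F x = ∑ (λ A → f (false ∷ insertAt A x b))

  absorb : ∀ b → ∑ (f ∘ (b ∷_)) + (∑ (λ A → # b A * f (true ∷ A)) + ∑ (λ A → # b A * f (false ∷ A)))
               ≡ ∑ (λ A → # b A * f A)
  absorb true  = begin
    ∑ (f ∘ (true ∷_)) + (∑ (λ A → # true A * f (true ∷ A)) + F′)
      ≡⟨ +-assoc (∑ (f ∘ (true ∷_))) _ _ ⟨
    ∑ (f ∘ (true ∷_)) + ∑ (λ A → # true A * f (true ∷ A)) + F′
      ≡⟨ cong (_+ F′) (∑-distrib (f ∘ (true ∷_)) (λ A → # true A * f (true ∷ A))) ⟨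
    ∑ (λ A → # true A * f A) ∎
    where F′ = ∑ (λ A → # true A * f (false ∷ A))
  absorb false = begin
    ∑ (f ∘ (false ∷_)) + (T′ + ∑ (λ A → # false A * f (false ∷ A)))
      ≡⟨ +-swap (∑ (f ∘ (false ∷_))) T′ _ ⟩
    T′ + (∑ (f ∘ (false ∷_)) + ∑ (λ A → # false A * f (false ∷ A)))
      ≡⟨ cong (T′ +_) (∑-distrib (f ∘ (false ∷_)) (λ A → # false A * f (false ∷ A))) ⟨
    ∑ (λ A → # false A * f A) ∎
    where
    T′ = ∑ (λ A → # false A * f (true ∷ A))

-- Maximal chains and the Lubell function.

-- The number of maximal chains of subsets of [n] that pass through A.
weight : Subset n → ℕ
weight A = # true A ! * # false A !

-- n ! times the Lubell function of G.
lubell : {G : Pred (Subset n) 0ℓ} → Decidable G → ℕ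
lubell G? = ∑ (λ A → ⟦ G? A ⟧ * weight A)

lubell-split : {G H : Pred (Subset n) 0ℓ} (G? : Decidable G) (H? : Decidable H) →
               lubell G? ≤ lubell (λ A → G? A ×-dec H? A) + lubell (λ A → G? A ×-dec ¬? (H? A))
lubell-split G? H? = begin
  lubell G?
    ≤⟨ ∑-mono (λ A → *-monoˡ-≤ (weight A) (⟦⟧-split (G? A) (H? A))) ⟩
  ∑ (λ A → (⟦ G? A ×-dec H? A ⟧ + ⟦ G? A ×-dec ¬? (H? A) ⟧) * weight A)
    ≡⟨ ∑-cong (λ A → *-distribʳ-+ (weight A) ⟦ G? A ×-dec H? A ⟧ _) ⟩
  ∑ (λ A → ⟦ G? A ×-dec H? A ⟧ * weight A + ⟦ G? A ×-dec ¬? (H? A) ⟧ * weight A)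
    ≡⟨ ∑-distrib (λ A → ⟦ G? A ×-dec H? A ⟧ * weight A) _ ⟩
  lubell (λ A → G? A ×-dec H? A) + lubell (λ A → G? A ×-dec ¬? (H? A)) ∎
  where open ≤-Reasoning

-- The weight of the set left after deleting an element x with A x ≡ b; junk if there is no such x.
weight⁻ : Bool → Subset n → ℕ
weight⁻ true  A = pred (# true A) ! * # false A !
weight⁻ false A = # true A ! * pred (# false A) !

weight⁻-insertAt : ∀ (A : Subset n) x b → weight⁻ b (insertAt A x b) ≡ weight A
weight⁻-insertAt A x true
  rewrite #-insertAt-≡ A x true | #-insertAt-not A x true = refl
weight⁻-insertAt A x false
  rewrite #-insertAt-≡ A x false | #-insertAt-not A x false = refl

!-step : ∀ m → m ≢ 0 → m ! ≡ m * pred m !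
!-step zero    m≢0 = contradiction refl m≢0
!-step (suc m) _   = refl

weight≡#*weight⁻ : ∀ (A : Subset n) b → # b A ≢ 0 → weight A ≡ # b A * weight⁻ b A
weight≡#*weight⁻ A true  #≢0 = trans
  (cong (_* # false A !) (!-step (# true A) #≢0)) (*-assoc (# true A) _ _)
weight≡#*weight⁻ A false #≢0 = trans
  (cong (# true A ! *_) (!-step (# false A) #≢0)) (*-swap (# true A !) (# false A) _)

-- Double counting: a set with # b A = j arises by insertion from j pairs, and has j times the weight
-- of each of them. Hence the Lubell function of G is the average over the facets of the cube, as
-- long as G avoids the one set lying on none of them.
lubell-insertAt : {G : Pred (Subset (suc n)) 0ℓ} (G? : Decidable G) (b : Bool) →
                  ¬ G (replicate (suc n) (not b)) →
                  lubell G? ≡ sum (λ x → lubell (λ A → G? (insertAt A x b)))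
lubell-insertAt {n} {G} G? b ¬G = begin
  lubell G?
    ≡⟨ ∑-cong reweight ⟩
  ∑ (λ A → # b A * (⟦ G? A ⟧ * weight⁻ b A))
    ≡⟨ sum-∑-insertAt (λ A → ⟦ G? A ⟧ * weight⁻ b A) b ⟨
  sum (λ x → ∑ (λ A → ⟦ G? (insertAt A x b) ⟧ * weight⁻ b (insertAt A x b)))
    ≡⟨ sum-cong-≗ (λ x → ∑-cong (λ A →
         cong (⟦ G? (insertAt A x b) ⟧ *_) (weight⁻-insertAt A x b))) ⟩
  sum (λ x → lubell (λ A → G? (insertAt A x b))) ∎
  where
  open ≡-Reasoning
  reweight : ∀ A → ⟦ G? A ⟧ * weight A ≡ # b A * (⟦ G? A ⟧ * weight⁻ b A)
  reweight A with G? A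
  ... | no _  = sym (*-zeroʳ (# b A))
  ... | yes g = trans (cong (1 *_) (weight≡#*weight⁻ A b #≢0)) (*-swap 1 (# b A) _)
    where
    #≢0 : # b A ≢ 0
    #≢0 #≡0 = ¬G (subst G (#≡0⇒≡replicate A b #≡0) g)

-- The sum of the reciprocals of the binomial coefficients.

-- With N = a + b + 2 this says that N choose t is at least N whenever 0 < t < N.
factorials≤ : ∀ a b → suc a ! * suc b ! ≤ suc (a + b) !
factorials≤ zero    b = ≤-reflexive (*-identityˡ (suc b !))
factorials≤ (suc a) b = begin
  suc (suc a) * suc a ! * suc b !    ≡⟨ *-assoc (suc (suc a)) (suc a !) (suc b !) ⟩
  suc (suc a) * (suc a ! * suc b !)  ≤⟨ *-mono-≤ (s≤s (s≤s (m≤m+n a b))) (factorials≤ a b) ⟩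
  suc (suc (a + b)) * suc (a + b) !  ∎
  where open ≤-Reasoning

-- The last term is `suc (n + a) !`, and each of the n others is at most `(n + a) !` by
-- `factorials≤`. The offset `a` serves the induction: removing the first term raises it by one.
sum-factorials-suc : ∀ a n →
  sum {suc n} (λ i → suc (toℕ i + a) ! * (n ∸ toℕ i) !) ≤ suc (n + a) ! + n * (n + a) !
sum-factorials-suc a zero    = ≤-reflexive (cong (_+ 0) (*-identityʳ _))
sum-factorials-suc a (suc n) = begin
  suc a ! * suc n ! + sum {suc n} (λ i → suc (suc (toℕ i + a)) ! * (n ∸ toℕ i) !)
    ≡⟨ cong (suc a ! * suc n ! +_) (sum-cong-≗ {suc n} (λ i →
         cong (λ j → suc j ! * (n ∸ toℕ i) !) (sym (+-suc (toℕ i) a)))) ⟩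
  suc a ! * suc n ! + sum {suc n} (λ i → suc (toℕ i + suc a) ! * (n ∸ toℕ i) !)
    ≤⟨ +-mono-≤ (factorials≤ a n) (sum-factorials-suc (suc a) n) ⟩
  suc (a + n) ! + (suc (n + suc a) ! + n * (n + suc a) !)
    ≡⟨ cong₂ (λ j k → suc j ! + (suc k ! + n * k !)) (+-comm a n) (+-suc n a) ⟩
  suc (n + a) ! + (suc (suc (n + a)) ! + n * suc (n + a) !)
    ≡⟨ +-swap (suc (n + a) !) (suc (suc (n + a)) !) _ ⟩
  suc (suc (n + a)) ! + suc n * suc (n + a) ! ∎
  where
  open ≤-Reasoning

-- Divided by `n !`, the left side is the sum of 1 / (n C t) over t. For positive n the two end
-- terms are 1 each, and the inner ones add up to at most 1.
sum-factorials : ∀ n → sum {suc n} (λ i → toℕ i ! * (n ∸ toℕ i) !) ≤ 3 * n !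
sum-factorials zero    = s≤s z≤n
sum-factorials (suc n) = begin
  1 * suc n ! + sum {suc n} (λ i → suc (toℕ i) ! * (n ∸ toℕ i) !)
    ≡⟨ cong₂ _+_ (*-identityˡ (suc n !)) (sum-cong-≗ {suc n} (λ i →
         cong (λ j → suc j ! * (n ∸ toℕ i) !) (sym (+-identityʳ (toℕ i))))) ⟩
  suc n ! + sum {suc n} (λ i → suc (toℕ i + 0) ! * (n ∸ toℕ i) !)
    ≤⟨ +-monoʳ-≤ (suc n !) (sum-factorials-suc 0 n) ⟩
  suc n ! + (suc (n + 0) ! + n * (n + 0) !)
    ≡⟨ cong (λ j → suc n ! + (suc j ! + n * j !)) (+-identityʳ n) ⟩
  suc n ! + (suc n ! + n * n !)
    ≤⟨ +-monoʳ-≤ (suc n !) (+-monoʳ-≤ (suc n !) (≤-trans (m≤n+m (n * n !) (n !)) (m≤m+n _ 0))) ⟩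
  3 * suc n ! ∎
  where open ≤-Reasoning

-- The Lubell function of a sparse family.

Slice : Pred (Subset n) 0ℓ → Subset n → Subset n → ℕ → Pred (Subset n) 0ℓ
Slice G Z Y t A = G A × Z ⊆ A × A ⊆ Y × ∣ A ∣ ≡ t

slice? : {G : Pred (Subset n) 0ℓ} → Decidable G → ∀ Z Y t → Decidable (Slice G Z Y t)
slice? G? Z Y t A = G? A ×-dec Z ⊆? A ×-dec A ⊆? Y ×-dec ∣ A ∣ ≟ t

width : {G : Pred (Subset n) 0ℓ} → Decidable G → Subset n → Subset n → ℕ → ℕ
width G? Z Y t = ∑ (λ A → ⟦ slice? G? Z Y t A ⟧)

-- Equivalently, no member of `G` is rich in `G`, with threshold `s`.
Sparse : {G : Pred (Subset n) 0ℓ} → Decidable G → ℕ → Set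
Sparse {n} {G} G? s = ∀ Z Y t → G Z → G Y → t ≤ n → width G? Z Y t ≤ s

bit : Bool → ℕ
bit true  = 1
bit false = 0

∣insertAt∣ : ∀ (A : Subset n) x b → ∣ insertAt A x b ∣ ≡ bit b + ∣ A ∣
∣insertAt∣ A x true  = #-insertAt-≡ A x true
∣insertAt∣ A x false = #-insertAt-not A x false

bit≤1 : ∀ b → bit b ≤ 1
bit≤1 true  = ≤-refl
bit≤1 false = z≤n

-- Insertion at `x` is injective and maps the slice of [Z, Y] at level t into the slice of [Z⁺, Y⁺]
-- at level t⁺; the new ends again belong to `G`.
sparse-insertAt : {G : Pred (Subset (suc n)) 0ℓ} (G? : Decidable G) {s : ℕ} → Sparse G? s →
                  ∀ x b → Sparse (λ A → G? (insertAt A x b)) s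
sparse-insertAt G? {s} sparse x b Z Y t Z∈G Y∈G t≤n = begin
  ∑ (λ A → ⟦ slice? (λ A → G? (insertAt A x b)) Z Y t A ⟧)
    ≤⟨ ∑-mono (λ A → ⟦⟧-mono (slice? (λ A → G? (insertAt A x b)) Z Y t A) (slice? G? Z⁺ Y⁺ t⁺ _)
         λ (A∈G , Z⊆A , A⊆Y , ∣A∣≡t) →
           A∈G , insertAt-⊆ x b Z⊆A , insertAt-⊆ x b A⊆Y ,
           trans (∣insertAt∣ A x b) (cong (bit b +_) ∣A∣≡t)) ⟩
  ∑ (λ A → ⟦ slice? G? Z⁺ Y⁺ t⁺ (insertAt A x b) ⟧)
    ≤⟨ ∑-insertAt≤ (λ A → ⟦ slice? G? Z⁺ Y⁺ t⁺ A ⟧) x b ⟩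
  width G? Z⁺ Y⁺ t⁺
    ≤⟨ sparse Z⁺ Y⁺ t⁺ Z∈G Y∈G (+-mono-≤ (bit≤1 b) t≤n) ⟩
  s ∎
  where
  open ≤-Reasoning
  Z⁺ = insertAt Z x b
  Y⁺ = insertAt Y x b
  t⁺ = bit b + t

-- The interval from `⊥` to `⊤` is the whole cube, so whole levels are bounded by `s`. The weight of
-- a set depends only on its size t, hence level t adds at most s / (n C t) to the Lubell function.
lubell-levels : {G : Pred (Subset n) 0ℓ} (G? : Decidable G) (s : ℕ) →
                (∀ {t} → t ≤ n → width G? ⊥ ⊤ t ≤ s) → lubell G? ≤ 3 * s * n !
lubell-levels {n} {G} G? s level≤s = begin
  lubell G?
    ≤⟨ ∑-mono single-level ⟩
  ∑ (λ A → sum {suc n} (λ i → φ (toℕ i) * ⟦ slice? G? ⊥ ⊤ (toℕ i) A ⟧))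
    ≡⟨ ∑-sum-comm (λ A (i : Fin (suc n)) → φ (toℕ i) * ⟦ slice? G? ⊥ ⊤ (toℕ i) A ⟧) ⟩
  sum {suc n} (λ i → ∑ (λ A → φ (toℕ i) * ⟦ slice? G? ⊥ ⊤ (toℕ i) A ⟧))
    ≡⟨ sum-cong-≗ {suc n} (λ i → ∑-*ˡ (φ (toℕ i)) (λ A → ⟦ slice? G? ⊥ ⊤ (toℕ i) A ⟧)) ⟩
  sum {suc n} (λ i → φ (toℕ i) * width G? ⊥ ⊤ (toℕ i))
    ≤⟨ sum-mono {suc n} (λ i → *-monoʳ-≤ (φ (toℕ i)) (level≤s (≤-pred (Fin.toℕ<n i)))) ⟩
  sum {suc n} (λ i → φ (toℕ i) * s)
    ≡⟨ sum-cong-≗ {suc n} (λ i → *-comm (φ (toℕ i)) s) ⟩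
  sum {suc n} (λ i → s * φ (toℕ i))
    ≡⟨ sum-*ˡ {suc n} s (φ ∘ toℕ) ⟩
  s * sum {suc n} (φ ∘ toℕ)
    ≤⟨ *-monoʳ-≤ s (sum-factorials n) ⟩
  s * (3 * n !)
    ≡⟨ *-assoc s 3 (n !) ⟨
  s * 3 * n !
    ≡⟨ cong (_* n !) (*-comm s 3) ⟩
  3 * s * n ! ∎
  where
  open ≤-Reasoning
  φ : ℕ → ℕ
  φ t = t ! * (n ∸ t) !

  weight≡φ : ∀ A → weight A ≡ φ ∣ A ∣
  weight≡φ A = cong (λ j → ∣ A ∣ ! * j !)
    (trans (sym (m+n∸m≡n ∣ A ∣ (# false A))) (cong (_∸ ∣ A ∣) (#true+#false A)))

  single-level : ∀ A → ⟦ G? A ⟧ * weight A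
                     ≤ sum {suc n} (λ i → φ (toℕ i) * ⟦ slice? G? ⊥ ⊤ (toℕ i) A ⟧)
  single-level A = begin
    ⟦ G? A ⟧ * weight A
      ≡⟨ *-comm ⟦ G? A ⟧ (weight A) ⟩
    weight A * ⟦ G? A ⟧
      ≤⟨ *-mono-≤ (≤-reflexive (trans (weight≡φ A) (cong φ (sym i≡∣A∣))))
           (⟦⟧-mono (G? A) (slice? G? ⊥ ⊤ (toℕ i) A) (λ g → g , ⊥⊆ , ⊆⊤ , sym i≡∣A∣)) ⟩
    φ (toℕ i) * ⟦ slice? G? ⊥ ⊤ (toℕ i) A ⟧
      ≤⟨ term≤sum (λ i → φ (toℕ i) * ⟦ slice? G? ⊥ ⊤ (toℕ i) A ⟧) i ⟩
    sum {suc n} (λ i → φ (toℕ i) * ⟦ slice? G? ⊥ ⊤ (toℕ i) A ⟧) ∎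
    where
    i : Fin (suc n)
    i = fromℕ< (s≤s (∣p∣≤n A))
    i≡∣A∣ : toℕ i ≡ ∣ A ∣
    i≡∣A∣ = Fin.toℕ-fromℕ< (s≤s (∣p∣≤n A))

-- The mutual recursion descends on n: `lubell-average` applies `lubell-sparse` to the facets, which
-- are cubes of one dimension less.
lubell-sparse : {G : Pred (Subset n) 0ℓ} (G? : Decidable G) {s : ℕ} → Sparse G? s →
                lubell G? ≤ 3 * s * n !
lubell-average : {G : Pred (Subset n) 0ℓ} (G? : Decidable G) {s : ℕ} → Sparse G? s →
                 ∀ b → ¬ G (replicate n (not b)) → lubell G? ≤ 3 * s * n !

lubell-sparse G? sparse with G? ⊥ | G? ⊤
... | yes ⊥∈G | yes ⊤∈G = lubell-levels G? _ (λ {t} → sparse ⊥ ⊤ t ⊥∈G ⊤∈G)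
-- With `b = true` the facets consist of the sets containing a given x, and together they cover
-- everything but `⊥`; dually for `false` and `⊤`.
... | no  ⊥∉G | _       = lubell-average G? sparse true ⊥∉G
... | yes _   | no ⊤∉G  = lubell-average G? sparse false ⊤∉G

lubell-average {zero}      G? sparse b ¬G =
  ≤-trans (≤-reflexive (cong (_* 1) (⟦⟧-false (G? []) ¬G))) z≤n
lubell-average {suc n} {G} G? {s} sparse b ¬G = begin
  lubell G?
    ≡⟨ lubell-insertAt G? b ¬G ⟩
  sum (λ x → lubell (λ A → G? (insertAt A x b)))
    ≤⟨ sum-mono (λ x → lubell-sparse (λ A → G? (insertAt A x b))
         (sparse-insertAt G? sparse x b)) ⟩
  sum {suc n} (λ _ → 3 * s * n !)
    ≡⟨ sum-const (suc n) (3 * s * n !) ⟩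
  suc n * (3 * s * n !)
    ≡⟨ *-swap (suc n) (3 * s) (n !) ⟩
  3 * s * suc n ! ∎
  where
  open ≤-Reasoning

-- Rich sets and towers of levels.

-- The bound on t allows a finite search, so richness is decidable and can split a family in two.
Rich : {G : Pred (Subset n) 0ℓ} → Decidable G → ℕ → Pred (Subset n) 0ℓ
Rich {n} {G} G? s Y = ∃ λ Z → G Z × ∃ λ t → t < suc n × s < width G? Z Y t

rich? : {G : Pred (Subset n) 0ℓ} (G? : Decidable G) (s : ℕ) → Decidable (Rich G? s)
rich? {n} G? s Y =
  anySubset? (λ Z → G? Z ×-dec anyUpTo? (λ t → s <? width G? Z Y t) (suc n))

width-mono : {G H : Pred (Subset n) 0ℓ} (G? : Decidable G) (H? : Decidable H) →
             (∀ {A} → G A → H A) → ∀ Z Y t → width G? Z Y t ≤ width H? Z Y t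
width-mono G? H? G⊆H Z Y t = ∑-mono λ A →
  ⟦⟧-mono (slice? G? Z Y t A) (slice? H? Z Y t A) (λ (A∈G , A∈slice) → G⊆H A∈G , A∈slice)

-- Richness is measured in all of `G`; passing to the subfamily only narrows the slices.
sparse-¬rich : {G : Pred (Subset n) 0ℓ} (G? : Decidable G) (s : ℕ) →
               Sparse (λ A → G? A ×-dec ¬? (rich? G? s A)) s
sparse-¬rich G? s Z Y t (Z∈G , _) (_ , ¬rich) t≤n = ≤-trans
  (width-mono (λ A → G? A ×-dec ¬? (rich? G? s A)) G? proj₁ Z Y t)
  (≮⇒≥ (λ s<width → ¬rich (Z , Z∈G , t , s≤s t≤n , s<width)))

-- Any choice of sets on the levels respects the order of colours, by `ascending`. The base is kept
-- for the induction: if it is rich, a further level fits beneath the others.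
record Tower {n : ℕ} (G : Pred (Subset n) 0ℓ) (s k : ℕ) : Set where
  field
    base       : Subset n
    base∈G     : G base
    level      : Fin k → Fin s → Subset n
    level-inj  : ∀ i → Injective _≡_ _≡_ (level i)
    level∈G    : ∀ i j → G (level i j)
    level-size : ∀ i j j′ → ∣ level i j ∣ ≡ ∣ level i j′ ∣
    base⊆level : ∀ i j → base ⊆ level i j
    ascending  : ∀ {i i′} → i <ᶠ i′ → ∀ j j′ → level i j ⊂ level i′ j′

-- At least two distinct sets of equal size lie below Y, so none of them is Y itself.
injective⇒⊂ : ∀ {s} {Y : Subset n} {u : Fin (suc (suc s)) → Subset n} → Injective _≡_ _≡_ u →
              (∀ i → u i ⊆ Y) → (∀ i j → ∣ u i ∣ ≡ ∣ u j ∣) → ∀ i → u i ⊂ Y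
injective⇒⊂ {Y = Y} {u} u-inj u⊆Y u-size i with ⊆⇒≡⊎⊂ (u⊆Y i)
... | inj₂ uᵢ⊂Y = uᵢ⊂Y
... | inj₁ uᵢ≡Y with ⊆⇒≡⊎⊂ (subst (u j ⊆_) (sym uᵢ≡Y) (u⊆Y j))
  where j = punchIn i zero
...   | inj₁ uⱼ≡uᵢ = contradiction (u-inj uⱼ≡uᵢ) (Fin.punchInᵢ≢i i zero)
...   | inj₂ uⱼ⊂uᵢ = contradiction (p⊂q⇒∣p∣<∣q∣ uⱼ⊂uᵢ) (<-irrefl (u-size _ i))

-- Let Y be the old base. Sets from a wide slice of [Z, Y] become the new lowest level and Z the new
-- base. There are at least two of them, so they lie strictly below Y and hence below all old
-- levels.
tower-extend : {G : Pred (Subset n) 0ℓ} (G? : Decidable G) {s k : ℕ} →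
               Tower (λ A → G A × Rich G? (suc s) A) (suc (suc s)) k → Tower G (suc (suc s)) (suc k)
tower-extend {n} {G} G? {s} {k} T with Tower.base∈G T
-- `s<width` unfolds to `suc (suc s) ≤ width G? Z Y t`, exactly the number of sets to be chosen.
... | Y∈G , Z , Z∈G , t , _ , s<width with choose (slice? G? Z (Tower.base T) t) s<width
...   | u , u-inj , u∈slice = record
  { base       = Z
  ; base∈G     = Z∈G
  ; level      = level⁺
  ; level-inj  = λ { zero → u-inj ; (suc i) → level-inj i }
  ; level∈G    = λ { zero j → proj₁ (u∈slice j) ; (suc i) j → proj₁ (level∈G i j) }
  ; level-size = λ { zero → u-size ; (suc i) → level-size i }
  ; base⊆level = λ { zero j → Z⊆u j ; (suc i) j → ⊆-trans Z⊆base (base⊆level i j) }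
  ; ascending  = λ { {zero}  {suc i′} _         j j′ → ⊂-⊆-trans (u⊂base j) (base⊆level i′ j′)
                   ; {suc i} {suc i′} (s≤s i<i′) j j′ → ascending i<i′ j j′ }
  }
  where
  open Tower T
  level⁺ : Fin (suc k) → Fin (suc (suc s)) → Subset n
  level⁺ zero    = u
  level⁺ (suc i) = level i

  Z⊆u : ∀ j → Z ⊆ u j
  Z⊆u j = proj₁ (proj₂ (u∈slice j))

  u-size : ∀ i j → ∣ u i ∣ ≡ ∣ u j ∣
  u-size i j = trans (proj₂ (proj₂ (proj₂ (u∈slice i)))) (sym (proj₂ (proj₂ (proj₂ (u∈slice j)))))

  u⊂base : ∀ j → u j ⊂ base
  u⊂base = injective⇒⊂ u-inj (λ j → proj₁ (proj₂ (proj₂ (u∈slice j)))) u-size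

  Z⊆base : Z ⊆ base
  Z⊆base = ⊆-trans (Z⊆u zero) (proj₁ (u⊂base zero))

-- The recursive call works inside the members rich in `G`, so its base is rich; the last level
-- added may use any members of `G`.
tower : {G : Pred (Subset n) 0ℓ} (G? : Decidable G) (s k : ℕ) →
        k * (3 * suc s) * n ! < lubell G? → Tower G (suc (suc s)) k
-- Even without levels a tower needs a base, and a positive Lubell function supplies one.
tower {G = G} G? s zero 0<lubell with anySubset? G?
... | yes (Z , Z∈G) = record
  { base       = Z
  ; base∈G     = Z∈G
  ; level      = λ ()
  ; level-inj  = λ ()
  ; level∈G    = λ ()
  ; level-size = λ ()
  ; base⊆level = λ ()
  ; ascending  = λ { {()} }
  }
... | no  G-empty   = contradiction
  (∑-zero (λ A → cong (_* weight A) (⟦⟧-false (G? A) (λ A∈G → G-empty (A , A∈G)))))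
  (≢-sym (<⇒≢ 0<lubell))
tower {n} {G} G? s (suc k) k<lubell =
  tower-extend G? (tower R? s k (+-cancelˡ-< (3 * suc s * n !) _ _ (begin-strict
    3 * suc s * n ! + k * (3 * suc s) * n !  ≡⟨ *-distribʳ-+ (n !) (3 * suc s) (k * (3 * suc s)) ⟨
    suc k * (3 * suc s) * n !                <⟨ k<lubell ⟩
    lubell G?                                ≤⟨ lubell-split G? (rich? G? (suc s)) ⟩
    lubell R? + lubell S?                    ≤⟨ +-monoʳ-≤ (lubell R?) S-small ⟩
    lubell R? + 3 * suc s * n !              ≡⟨ +-comm (lubell R?) _ ⟩
    3 * suc s * n ! + lubell R?              ∎)))
  where
  open ≤-Reasoning
  R? = λ A → G? A ×-dec rich? G? (suc s) A
  S? = λ A → G? A ×-dec ¬? (rich? G? (suc s) A)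
  S-small : lubell S? ≤ 3 * suc s * n !
  S-small = lubell-sparse S? (sparse-¬rich G? (suc s))

-- The central binomial coefficient and the size of a family.

-- Cancelling `a ! * q !` leaves (a + 1) ... (a + d) on the left and (q + 1) ... (q + d) on the
-- right, compared factor by factor.
!-*-shift : ∀ d {a q} → a ≤ q → (a + d) ! * q ! ≤ a ! * (q + d) !
!-*-shift zero    {a} {q} _   =
  ≤-reflexive (cong₂ (λ j k → j ! * k !) (+-identityʳ a) (sym (+-identityʳ q)))
!-*-shift (suc d) {a} {q} a≤q = begin
  (a + suc d) ! * q !                ≡⟨ cong (λ j → j ! * q !) (+-suc a d) ⟩
  suc (a + d) * (a + d) ! * q !      ≡⟨ *-assoc (suc (a + d)) ((a + d) !) (q !) ⟩
  suc (a + d) * ((a + d) ! * q !)    ≤⟨ *-mono-≤ (s≤s (+-monoˡ-≤ d a≤q)) (!-*-shift d a≤q) ⟩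
  suc (q + d) * (a ! * (q + d) !)    ≡⟨ *-swap (suc (q + d)) (a !) _ ⟩
  a ! * suc (q + d) !                ≡⟨ cong (λ j → a ! * j !) (+-suc q d) ⟨
  a ! * (q + suc d) !                ∎
  where open ≤-Reasoning

-- This is the maximality of the central binomial coefficient. If `a ≤ p`, then d = p - a units move
-- from `p` to `q`; otherwise d = a - p units move from `q` to `p`.
!-*-balanced : ∀ {p q a b} → p ≤ q → q ≤ suc p → a + b ≡ p + q → p ! * q ! ≤ a ! * b !
!-*-balanced {p} {q} {a} {b} p≤q q≤1+p a+b≡p+q with a ≤? p
... | yes a≤p with m≤n⇒∃[o]m+o≡n a≤p
...   | d , refl = begin
  (a + d) ! * q !  ≤⟨ !-*-shift d (≤-trans a≤p p≤q) ⟩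
  a ! * (q + d) !  ≡⟨ cong (λ j → a ! * j !) b≡q+d ⟨
  a ! * b !        ∎
  where
  open ≤-Reasoning
  b≡q+d : b ≡ q + d
  b≡q+d = +-cancelˡ-≡ a _ _ (trans a+b≡p+q (trans (+-assoc a d q) (cong (a +_) (+-comm d q))))
!-*-balanced {p} {q} {a} {b} p≤q q≤1+p a+b≡p+q | no a≰p with m≤n⇒∃[o]m+o≡n (<⇒≤ (≰⇒> a≰p))
...   | d , refl = begin
  p ! * q !        ≡⟨ *-comm (p !) (q !) ⟩
  q ! * p !        ≡⟨ cong (λ j → j ! * p !) q≡b+d ⟩
  (b + d) ! * p !  ≤⟨ !-*-shift d b≤p ⟩
  b ! * (p + d) !  ≡⟨ *-comm (b !) _ ⟩
  (p + d) ! * b !  ∎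
  where
  open ≤-Reasoning
  q≡b+d : q ≡ b + d
  q≡b+d = +-cancelˡ-≡ p _ _ (trans (sym a+b≡p+q) (trans (+-assoc p d b) (cong (p +_) (+-comm d b))))
  -- Here near-balance enters: since `a` exceeds `p`, d is positive and `suc p ≤ p + d`.
  b≤p : b ≤ p
  b≤p = +-cancelʳ-≤ d b p (begin
    b + d        ≡⟨ q≡b+d ⟨
    q            ≤⟨ q≤1+p ⟩
    suc p        ≤⟨ ≰⇒> a≰p ⟩
    p + d        ∎)

n!≡nCk*k![n∸k]! : ∀ {n k} → k ≤ n → n ! ≡ (n C k) * (k ! * (n ∸ k) !)
n!≡nCk*k![n∸k]! {n} {k} k≤n = sym (trans
  (cong (_* (k ! * (n ∸ k) !)) (nCk≡n!/k![n-k]! k≤n))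
  (m/n*n≡m {{k !* (n ∸ k) !≢0}} (k![n∸k]!∣n! k≤n)))

-- Every set thus adds at least 1 / (n C (n / 2)) to the Lubell function of a family containing it.
n!≤central*weight : ∀ (A : Subset n) → n ! ≤ (n C (n / 2)) * weight A
n!≤central*weight {n} A = begin
  n !
    ≡⟨ n!≡nCk*k![n∸k]! p≤n ⟩
  (n C p) * (p ! * (n ∸ p) !)
    ≤⟨ *-monoʳ-≤ (n C p) (!-*-balanced {a = # true A} p≤q q≤1+p sizes) ⟩
  (n C p) * weight A ∎
  where
  open ≤-Reasoning
  p = n / 2
  p≤n = m/n≤m n 2
  p*2≡p+p : p * 2 ≡ p + p
  p*2≡p+p = trans (*-comm p 2) (cong (p +_) (+-identityʳ p))
  q≡r+p : n ∸ p ≡ n % 2 + p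
  q≡r+p = begin-equality
    n ∸ p                  ≡⟨ cong (_∸ p) (m≡m%n+[m/n]*n n 2) ⟩
    n % 2 + p * 2 ∸ p      ≡⟨ cong (λ j → n % 2 + j ∸ p) p*2≡p+p ⟩
    n % 2 + (p + p) ∸ p    ≡⟨ cong (_∸ p) (+-assoc (n % 2) p p) ⟨
    n % 2 + p + p ∸ p      ≡⟨ m+n∸n≡m (n % 2 + p) p ⟩
    n % 2 + p              ∎
  p≤q : p ≤ n ∸ p
  p≤q = subst (p ≤_) (sym q≡r+p) (m≤n+m p (n % 2))
  q≤1+p : n ∸ p ≤ suc p
  q≤1+p = subst (_≤ suc p) (sym q≡r+p) (+-monoˡ-≤ p (≤-pred (m%n<n n 2)))
  sizes : # true A + # false A ≡ p + (n ∸ p)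
  sizes = trans (#true+#false A) (sym (m+[n∸m]≡n p≤n))

-- Uniqueness keeps B out of F, so the indicators of B and of F have disjoint supports.
length≤∑ : {F : List (Subset n)} → Unique F → length F ≤ ∑ (λ A → ⟦ A ∈? F ⟧)
length≤∑ []ᵘ = z≤n
length≤∑ {F = B ∷ F} (B∉F ∷ᵘ unique) = begin
  1 + length F
    ≤⟨ +-mono-≤ (≤-trans (≤-reflexive (sym (⟦⟧-true (≡-dec Bool._≟_ B B) refl)))
                         (term≤∑ (λ A → ⟦ ≡-dec Bool._≟_ A B ⟧) B))
                (length≤∑ unique) ⟩
  ∑ (λ A → ⟦ ≡-dec Bool._≟_ A B ⟧) + ∑ (λ A → ⟦ A ∈? F ⟧)
    ≡⟨ ∑-distrib (λ A → ⟦ ≡-dec Bool._≟_ A B ⟧) (λ A → ⟦ A ∈? F ⟧) ⟨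
  ∑ (λ A → ⟦ ≡-dec Bool._≟_ A B ⟧ + ⟦ A ∈? F ⟧)
    ≤⟨ ∑-mono disjoint ⟩
  ∑ (λ A → ⟦ A ∈? (B ∷ F) ⟧) ∎
  where
  open ≤-Reasoning
  disjoint : ∀ A → ⟦ ≡-dec Bool._≟_ A B ⟧ + ⟦ A ∈? F ⟧ ≤ ⟦ A ∈? (B ∷ F) ⟧
  disjoint A with ≡-dec Bool._≟_ A B
  ... | yes refl = ≤-reflexive (cong suc (⟦⟧-false (A ∈? F) (λ A∈F → All.lookup B∉F A∈F refl)))
  -- Membership in `B ∷ F` is decided by a disjunction; once A differs from B, its indicator
  -- computes to that of membership in F.
  ... | no A≢B   = ⟦⟧-mono (A ∈? F) (A ∈? F) id

length*n!≤central*lubell : {F : List (Subset n)} → Unique F →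
                           length F * n ! ≤ (n C (n / 2)) * lubell (_∈? F)
length*n!≤central*lubell {n} {F} unique = begin
  length F * n !
    ≤⟨ *-monoˡ-≤ (n !) (length≤∑ unique) ⟩
  ∑ (λ A → ⟦ A ∈? F ⟧) * n !
    ≡⟨ *-comm _ (n !) ⟩
  n ! * ∑ (λ A → ⟦ A ∈? F ⟧)
    ≡⟨ ∑-*ˡ (n !) (λ A → ⟦ A ∈? F ⟧) ⟨
  ∑ (λ A → n ! * ⟦ A ∈? F ⟧)
    ≤⟨ ∑-mono (λ A → *-monoˡ-≤ ⟦ A ∈? F ⟧ (n!≤central*weight A)) ⟩
  ∑ (λ A → (n C (n / 2)) * weight A * ⟦ A ∈? F ⟧)
    ≡⟨ ∑-cong {n} (λ A → trans
         (*-assoc (n C (n / 2)) (weight A) ⟦ A ∈? F ⟧)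
         (cong ((n C (n / 2)) *_) (*-comm (weight A) ⟦ A ∈? F ⟧))) ⟩
  ∑ (λ A → (n C (n / 2)) * (⟦ A ∈? F ⟧ * weight A))
    ≡⟨ ∑-*ˡ (n C (n / 2)) (λ A → ⟦ A ∈? F ⟧ * weight A) ⟩
  (n C (n / 2)) * lubell (_∈? F) ∎
  where open ≤-Reasoning

-- From a tower to a coloured embedding.

tower-embedding : ∀ {m k} {_<p_ : Rel (Fin m) 0ℓ} {c : Fin m → Fin k} →
                  (∀ {a b} → a <p b → c a <ᶠ c b) →
                  {F : List (Subset n)} → Tower (_∈ F) (suc (suc m)) k →
                  ∃ λ (f : Fin m → Subset n) → ColorEmbedding _<p_ c F f
tower-embedding {c = c} c-mono T = f , record
  { injective   = f-injective
  ; monotone    = λ a<b → ascending (c-mono a<b) _ _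
  ; inFamily    = λ a → level∈G (c a) _
  ; colorLevels = λ a b ca≡cb → trans
      (level-size (c a) (2 ↑ʳ a) (2 ↑ʳ b)) (cong (λ i → ∣ level i (2 ↑ʳ b) ∣) ca≡cb)
  }
  where
  open Tower T
  -- Each element owns one slot, the same on every level, so elements of one colour get distinct
  -- sets. The shift by 2 fits the width `suc (suc m)`, which guarantees two sets per level even for
  -- small m.
  f = λ a → level (c a) (2 ↑ʳ a)

  f-injective : Injective _≡_ _≡_ f
  f-injective {a} {b} fa≡fb with Fin.<-cmp (c a) (c b)
  ... | tri< ca<cb _ _ = contradiction (ascending ca<cb _ _) (⊂-irref fa≡fb)
  ... | tri> _ _ cb<ca = contradiction (ascending cb<ca _ _) (⊂-irref (sym fa≡fb))
  ... | tri≈ _ ca≡cb _ = Fin.↑ʳ-injective 2 a b (level-inj (c a)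
    (trans fa≡fb (cong (λ i → level i (2 ↑ʳ b)) (sym ca≡cb))))

theorem3p2 : (m k : ℕ) (_<p_ : Rel (Fin m) 0ℓ) → IsStrictPartialOrder _≡_ _<p_ →
    (c : Fin m → Fin k) → Surjective _≡_ _≡_ c → (∀ {a b} → a <p b → c a <ᶠ c b) →
    Σ ℕ λ B → (n : ℕ) (F : List (Subset n)) → Unique F →
    B * (n C (n / 2)) < length F →
    ∃ λ (f : Fin m → Subset n) → ColorEmbedding _<p_ c F f
theorem3p2 m k _<p_ _ c _ c-mono = B , λ n F unique large →
  -- The size hypothesis times `n !` is compared with the Lubell function; cancelling the binomial
  -- coefficient leaves `B * n ! < lubell (_∈? F)`.
  tower-embedding c-mono (tower (_∈? F) m k (*-cancelˡ-< (n C (n / 2)) _ _ (begin-strict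
    (n C (n / 2)) * (B * n !)       ≡⟨ *-assoc (n C (n / 2)) B (n !) ⟨
    (n C (n / 2)) * B * n !         ≡⟨ cong (_* n !) (*-comm (n C (n / 2)) B) ⟩
    B * (n C (n / 2)) * n !         <⟨ *-monoˡ-< (n !) {{n !≢0}} large ⟩
    length F * n !                  ≤⟨ length*n!≤central*lubell unique ⟩
    (n C (n / 2)) * lubell (_∈? F)  ∎)))
  where
  open ≤-Reasoning
  -- Levels of `suc (suc m)` sets need the richness threshold `suc m`, and each of the k levels
  -- costs three times that threshold.
  B = k * (3 * suc m)
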